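{- Let $G$ be a finite simple graph with at least one isolated vertex, let $T$ be a (possibly empty) minimum twin cover of $G$, and let $t \geq 1$. (i) If $G = K_1$, then $\det(G) = 0$ and $\det(\mu_t(G)) = t$. (ii) If $G \neq K_1$, then $\det(\mu_t(G)) = t|T| + \det(G) + t - 1$.
   Context: Two vertices are twins if they have the same open neighborhood. A minimum twin cover of a graph is a minimum size set of vertices containing at least one vertex of every pair of twin vertices (empty if the graph has no twins). For a finite simple graph $G$ with $V(G)=\{v_1,\dots,v_n\}$ and $t\ge 1$, the generalized Mycielskian $\mu_t(G)$ has vertex set $\{u_i^s : 1\le i\le n,\ 0\le s\le t\}\cup\{w\}$, where $u_i^0=v_i$. For each edge $v_iv_j$ of $G$, $\mu_t(G)$ has the edge $u_i^0u_j^0$ and the edges $u_i^su_j^{s+1}$ and $u_j^su_i^{s+1}$ for $0\le s<t$; in addition $u_i^t w$ is an edge for every $i$. There are no other edges. A determining set is a vertex subset such that the only automorphism fixing each of its vertices is the identity; $\det(G)$ is the minimum size of a determining set. -}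

module Defs where

open import Data.Nat using (ℕ; zero; suc; _*_; _≡ᵇ_)
open import Data.Bool using (Bool; true; false; _∨_; _∧_; if_then_else_)
open import Data.Fin using (Fin; toℕ; remQuot) renaming (zero to fzero; suc to fsuc)
open import Data.Fin.Subset using (Subset; _∈_; ∣_∣)
open import Data.Fin.Permutation using (Permutation′; _⟨$⟩ʳ_)
open import Data.Product using (_×_; Σ; _,_)
open import Data.Sum using (_⊎_)
open import Data.Nat using (_≤_)
open import Relation.Binary.PropositionalEquality using (_≡_; _≢_)

Graph : ℕ → Set
Graph n = Fin n → Fin n → Bool

IsSimple : ∀ {n} → Graph n → Set
IsSimple {n} G = (∀ (i j : Fin n) → G i j ≡ G j i) × (∀ (i : Fin n) → G i i ≡ false)

HasIsolatedVertex : ∀ {n} → Graph n → Set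
HasIsolatedVertex {n} G = Σ (Fin n) λ i → ∀ (j : Fin n) → G i j ≡ false

IsAutomorphism : ∀ {n} → Graph n → Permutation′ n → Set
IsAutomorphism {n} G σ = ∀ (i j : Fin n) → G (σ ⟨$⟩ʳ i) (σ ⟨$⟩ʳ j) ≡ G i j

IsDeterminingSet : ∀ {n} → Graph n → Subset n → Set
IsDeterminingSet {n} G S =
  ∀ (σ : Permutation′ n) → IsAutomorphism G σ →
    (∀ (i : Fin n) → i ∈ S → σ ⟨$⟩ʳ i ≡ i) → ∀ (i : Fin n) → σ ⟨$⟩ʳ i ≡ i

IsDet : ∀ {n} → Graph n → ℕ → Set
IsDet {n} G d =
  (Σ (Subset n) λ S → IsDeterminingSet G S × ∣ S ∣ ≡ d) ×
  (∀ (S : Subset n) → IsDeterminingSet G S → d ≤ ∣ S ∣)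

AreTwins : ∀ {n} → Graph n → Fin n → Fin n → Set
AreTwins {n} G i j = i ≢ j × (∀ (k : Fin n) → G i k ≡ G j k)

IsTwinCover : ∀ {n} → Graph n → Subset n → Set
IsTwinCover {n} G T = ∀ (i j : Fin n) → AreTwins G i j → i ∈ T ⊎ j ∈ T

IsMinTwinCover : ∀ {n} → Graph n → Subset n → Set
IsMinTwinCover {n} G T =
  IsTwinCover G T × (∀ (T' : Subset n) → IsTwinCover G T' → ∣ T ∣ ≤ ∣ T' ∣)

-- Generalized Mycielskian μ_t(G).
-- Vertex set Fin (suc (n * suc t)): fzero is w, and fsuc k encodes u_i^s
-- where (i , s) = remQuot (suc t) k, with i : Fin n and s : Fin (suc t).
data MyVertex (n t : ℕ) : Set where
  root : MyVertex n t
  layer : Fin n → Fin (suc t) → MyVertex n t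

decodeμ : ∀ {n} t → Fin (suc (n * suc t)) → MyVertex n t
decodeμ t fzero = root
decodeμ {n} t (fsuc k) with remQuot {n} (suc t) k
... | i , s = layer i s

adjμ : ∀ {n} t → Graph n → MyVertex n t → MyVertex n t → Bool
adjμ t G root root = false
adjμ t G root (layer j r) = toℕ r ≡ᵇ t
adjμ t G (layer i s) root = toℕ s ≡ᵇ t
adjμ t G (layer i s) (layer j r) =
  if ((toℕ s ≡ᵇ 0) ∧ (toℕ r ≡ᵇ 0)) ∨ (toℕ r ≡ᵇ suc (toℕ s)) ∨ (toℕ s ≡ᵇ suc (toℕ r))
  then G i j else false

μ : ∀ {n} (t : ℕ) → Graph n → Graph (suc (n * suc t))
μ t G x y = adjμ t G (decodeμ t x) (decodeμ t y)

{-# OPTIONS --safe #-}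

-- A determining set meets every pair of twins. In μ_t(G) the copies of twins of G within one layer
-- are twins, and so are any two copies of isolated vertices below the top layer. For n ≥ 2 every
-- automorphism fixes w, the only neighbour of a leaf, and hence preserves the layers of the
-- non-isolated vertices; it acts on layer 0 by an automorphism of G, and up to twins the action on
-- each layer is forced by the one below.
--
-- Upper bound: a minimum determining set of G in layer 0, T in the layers 1, …, t, and in the layers
-- 1, …, t − 1 also the isolated vertex v outside T.
--
-- Lower bound: let S determine μ_t(G), let S_s be its part in layer s and E_s the set of vertices
-- outside T whose whole twin class lies in S_s. Then S_s ∖ E_s is a twin cover, so
-- |S_s| ≥ |T| + |E_s|. An automorphism of G fixing T ∪ ⋃ E_s ∖ {v} lifts layerwise to one fixing S,
-- so this set determines G, while v lies in E_s for all but one of the layers below the top.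
module Submission where

open import Defs
open import Data.Nat using (ℕ; zero; suc; _+_; _*_; _∸_; _≤_; z≤n; s≤s; _≡ᵇ_)
import Data.Nat.Properties as ℕ
open import Data.Bool using (Bool; true; false; not; _∧_; _∨_; if_then_else_)
import Data.Bool.Properties as Bool
open import Data.Fin using (Fin; toℕ; fromℕ; fromℕ<; inject₁; combine; _↑ˡ_; _↑ʳ_; pred)
  renaming (zero to fzero; suc to fsuc)
import Data.Fin.Properties as Fin
open import Data.Fin.Permutation using (permutation; transpose; _⟨$⟩ʳ_; _⟨$⟩ˡ_; inverseˡ; inverseʳ)
open import Data.Fin.Subset using (Subset; ∣_∣; _∈_; _-_; ⊥)
import Data.Fin.Subset.Properties as Subset
open import Data.Product using (_×_; _,_; proj₁; proj₂; ∃; Σ)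
open import Data.Sum using (_⊎_; inj₁; inj₂; [_,_]′)
import Data.Sum as Sum
open import Data.Vec using ([]; _∷_; lookup; tabulate)
open import Data.Vec.Properties using (lookup∘tabulate; []=⇒lookup; lookup⇒[]=)
open import Algebra.Properties.Semiring.Sum ℕ.+-*-semiring
  using (sum; sum-syntax; ∑-distrib-+; ∑-comm; sum-cong-≗; sum-init-last; *-distribˡ-sum)
open import Function using (_∘_; Equivalence; mk↣)
open import Relation.Nullary using (Dec; yes; no; ¬_; does; contradiction)
open import Relation.Nullary.Decidable using (dec-true; dec-false; _×-dec_; _→-dec_; via-injection)
open import Relation.Binary.Definitions using (DecidableEquality)
open import Relation.Binary.PropositionalEquality

private variable
  A : Set
  n : ℕ

-- Counting with sums over `Fin n`.

bit : Bool → ℕ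
bit true  = 1
bit false = 0

∣p∣≡∑ : (p : Subset n) → ∣ p ∣ ≡ ∑[ i < n ] bit (lookup p i)
∣p∣≡∑ []          = refl
∣p∣≡∑ (true  ∷ p) = cong suc (∣p∣≡∑ p)
∣p∣≡∑ (false ∷ p) = ∣p∣≡∑ p

∣tabulate∣≡∑ : (f : Fin n → Bool) → ∣ tabulate f ∣ ≡ ∑[ i < n ] bit (f i)
∣tabulate∣≡∑ f = trans (∣p∣≡∑ (tabulate f)) (sum-cong-≗ λ i → cong bit (lookup∘tabulate f i))

∑-mono-≤ : {f g : Fin n → ℕ} → (∀ i → f i ≤ g i) → sum f ≤ sum g
∑-mono-≤ {zero}  f≤g = z≤n
∑-mono-≤ {suc n} f≤g = ℕ.+-mono-≤ (f≤g fzero) (∑-mono-≤ (f≤g ∘ fsuc))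

term≤∑ : (f : Fin n → ℕ) (i : Fin n) → f i ≤ sum f
term≤∑ f fzero    = ℕ.m≤m+n _ _
term≤∑ f (fsuc i) = ℕ.≤-trans (term≤∑ (f ∘ fsuc) i) (ℕ.m≤n+m _ _)

∑-const : ∀ n c → ∑[ i < n ] c ≡ n * c
∑-const zero    c = refl
∑-const (suc n) c = cong (c +_) (∑-const n c)

∑-zero : {f : Fin n → ℕ} → (∀ i → f i ≡ 0) → sum f ≡ 0
∑-zero {n} f≡0 = trans (sum-cong-≗ f≡0) (trans (∑-const n 0) (ℕ.*-zeroʳ n))

∑-δ : (v : Fin n) (c : ℕ) → ∑[ i < n ] (bit (does (v Fin.≟ i)) * c) ≡ c
∑-δ {suc n} fzero c =
  trans (cong₂ _+_ (ℕ.*-identityˡ c) (∑-zero {n} λ _ → refl)) (ℕ.+-identityʳ c)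
∑-δ (fsuc v) c = ∑-δ v c

∑-split : ∀ m {k} (f : Fin (m + k) → ℕ) →
  sum f ≡ ∑[ i < m ] f (i ↑ˡ k) + ∑[ j < k ] f (m ↑ʳ j)
∑-split zero    f = refl
∑-split (suc m) f = trans (cong (f fzero +_) (∑-split m (f ∘ fsuc))) (sym (ℕ.+-assoc (f fzero) _ _))

∑-combine : ∀ n {k} (f : Fin (n * k) → ℕ) →
  sum f ≡ ∑[ i < n ] ∑[ s < k ] f (combine i s)
∑-combine zero        f = refl
∑-combine (suc n) {k} f = trans (∑-split k f) (cong (sum (λ s → f (s ↑ˡ (n * k))) +_) (∑-combine n (f ∘ (k ↑ʳ_))))

∑-allTrue : {f : Fin n → Bool} → (∀ i → f i ≡ true) → ∑[ i < n ] bit (f i) ≡ n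
∑-allTrue {n} all = trans (sum-cong-≗ (cong bit ∘ all)) (trans (∑-const n 1) (ℕ.*-identityʳ n))

-- After the first `false` all later values must be `true`. This serves to count layers below the
-- top, where copies of isolated vertices in different layers are twins.
∑-atMostOneFalse : (f : Fin n → Bool) → (∀ {i j} → i ≢ j → f i ≡ true ⊎ f j ≡ true) →
  n ≤ suc (∑[ i < n ] bit (f i))
∑-atMostOneFalse {zero}  f atMostOne = z≤n
∑-atMostOneFalse {suc n} f atMostOne with f fzero in f0
... | true  = s≤s (∑-atMostOneFalse (f ∘ fsuc) λ i≢j → atMostOne (i≢j ∘ Fin.suc-injective))
... | false = s≤s (ℕ.≤-reflexive (sym (∑-allTrue rest)))
  where
  rest : ∀ i → f (fsuc i) ≡ true
  rest i with atMostOne {fzero} {fsuc i} (λ ())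
  ... | inj₁ h = contradiction (trans (sym f0) h) λ ()
  ... | inj₂ h = h

true≢false : ∀ {b} → b ≡ true → b ≢ false
true≢false refl ()

if-false : ∀ c {b} → b ≡ false → (if c then b else false) ≡ false
if-false true  b≡false = b≡false
if-false false _       = refl

≡-fromTrue : ∀ {a b} → (a ≡ true → b ≡ true) → (b ≡ true → a ≡ true) → a ≡ b
≡-fromTrue {true}          f g = sym (f refl)
≡-fromTrue {false} {true}  f g = g refl
≡-fromTrue {false} {false} f g = refl

∈⇒true : {p : Subset n} {i : Fin n} → i ∈ p → lookup p i ≡ true
∈⇒true = []=⇒lookup

true⇒∈ : {p : Subset n} {i : Fin n} → lookup p i ≡ true → i ∈ p
true⇒∈ {p = p} {i} = lookup⇒[]= i p

-- Twins and isolated vertices.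

SameNbhd : (A → A → Bool) → A → A → Set
SameNbhd adj x y = ∀ z → adj x z ≡ adj y z

Covers : (A → A → Bool) → (A → Bool) → Set
Covers adj p = ∀ {x y} → x ≢ y → SameNbhd adj x y → p x ≡ true ⊎ p y ≡ true

Isolated : Graph n → Fin n → Set
Isolated G i = ∀ k → G i k ≡ false

isolated-twins : (G : Graph n) {i j : Fin n} → Isolated G i → Isolated G j → SameNbhd G i j
isolated-twins G iso-i iso-j k = trans (iso-i k) (sym (iso-j k))

twinCover⇒covers : {G : Graph n} {T : Subset n} → IsTwinCover G T → Covers G (lookup T)
twinCover⇒covers cover {i} {j} i≢j same = Sum.map ∈⇒true ∈⇒true (cover i j (i≢j , same))

-- The isolated vertices form one twin class. If `T` contained all of them, removing one would leave
-- a twin cover, against minimality.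
uncovered-isolated : {G : Graph n} → HasIsolatedVertex G → {T : Subset n} → IsMinTwinCover G T →
  ∃ λ v → Isolated G v × lookup T v ≡ false
uncovered-isolated {n} {G} (v , iso-v) {T} (cover , minimal)
  with Fin.any? (λ i → Fin.all? (λ k → G i k Bool.≟ false) ×-dec (lookup T i Bool.≟ false))
... | yes found = found
... | no all-covered = contradiction (minimal (T - v) T-v-cover)
        (ℕ.<⇒≱ (Subset.x∈p⇒∣p-x∣<∣p∣ (isolated∈T iso-v)))
  where
  isolated∈T : ∀ {i} → Isolated G i → i ∈ T
  isolated∈T {i} iso with lookup T i in Ti
  ... | true  = true⇒∈ Ti
  ... | false = contradiction (i , iso , Ti) all-covered

  T-v-cover : IsTwinCover G (T - v)
  T-v-cover i j (i≢j , same) with i Fin.≟ v | j Fin.≟ v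
  ... | yes refl | yes refl = contradiction refl i≢j
  ... | yes refl | no j≢v   =
    inj₂ (Subset.x∈p∧x≢y⇒x∈p-y (isolated∈T λ k → trans (sym (same k)) (iso-v k)) j≢v)
  ... | no i≢v   | yes refl =
    inj₁ (Subset.x∈p∧x≢y⇒x∈p-y (isolated∈T λ k → trans (same k) (iso-v k)) i≢v)
  ... | no i≢v   | no j≢v   = Sum.map
    (λ h → Subset.x∈p∧x≢y⇒x∈p-y h i≢v) (λ h → Subset.x∈p∧x≢y⇒x∈p-y h j≢v) (cover i j (i≢j , same))

isDet : {G : Graph n} {d : ℕ} → (∀ S → IsDeterminingSet G S → d ≤ ∣ S ∣) →
  (S : Subset n) → IsDeterminingSet G S → ∣ S ∣ ≤ d → IsDet G d
isDet lower S det upper = (S , det , ℕ.≤-antisym upper (lower S det)) , lower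

-- Automorphisms and determining sets over an arbitrary vertex type.

record Aut {A : Set} (adj : A → A → Bool) : Set where
  field
    to from : A → A
    to-from : ∀ x → to (from x) ≡ x
    from-to : ∀ x → from (to x) ≡ x
    adj-to  : ∀ x y → adj (to x) (to y) ≡ adj x y

  to-injective : ∀ {x y} → to x ≡ to y → x ≡ y
  to-injective {x} {y} e = trans (sym (from-to x)) (trans (cong from e) (from-to y))

  adj-toˡ : ∀ x y → adj (to x) y ≡ adj x (from y)
  adj-toˡ x y = trans (cong (adj (to x)) (sym (to-from y))) (adj-to x (from y))

  Fixes : (A → Bool) → Set
  Fixes p = ∀ x → p x ≡ true → to x ≡ x

  -- If `p` contains `to x` rather than `x`, then `to` fixes `to x`, and injectivity brings this
  -- back to `x`.
  fixed : DecidableEquality A → ∀ {p} → Fixes p → ∀ {x} →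
    (x ≢ to x → p x ≡ true ⊎ p (to x) ≡ true) → to x ≡ x
  fixed _≟_ fix {x} cover with x ≟ to x
  ... | yes e = sym e
  ... | no x≢ = [ fix x , (λ h → to-injective (fix (to x) h)) ]′ (cover x≢)

open Aut

_⁻¹ : {adj : A → A → Bool} → Aut adj → Aut adj
_⁻¹ {adj = adj} α = record
  { to = from α ; from = to α ; to-from = from-to α ; from-to = to-from α
  ; adj-to = λ x y → trans (sym (adj-to α (from α x) (from α y))) (cong₂ adj (to-from α x) (to-from α y)) }

-- The vertex type is left open so that the Mycielskian can be treated on `MyVertex`, where layers
-- are visible, instead of on `Fin`.
Determines : (A → A → Bool) → (A → Bool) → Set
Determines adj p = ∀ (α : Aut adj) → Fixes α p → ∀ x → to α x ≡ x

determining⇒ : (G : Graph n) (S : Subset n) → IsDeterminingSet G S → Determines G (lookup S)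
determining⇒ G S det α fix =
  det (permutation (to α) (from α) (to-from α) (from-to α)) (adj-to α)
      (λ i i∈S → fix i (∈⇒true i∈S))

⇒determining : (G : Graph n) (f : Fin n → Bool) → Determines G f → IsDeterminingSet G (tabulate f)
⇒determining G f det σ aut fix =
  det (record { to = σ ⟨$⟩ʳ_ ; from = σ ⟨$⟩ˡ_ ; to-from = λ _ → inverseʳ σ ; from-to = λ _ → inverseˡ σ ; adj-to = aut })
      (λ i fi → fix i (true⇒∈ (trans (lookup∘tabulate f i) fi)))

transpose-matchˡ : (x y : Fin n) → transpose x y ⟨$⟩ʳ x ≡ y
transpose-matchˡ x y with x Fin.≟ x
... | yes _  = refl
... | no x≢x = contradiction refl x≢x

-- The transposition of x and y is an automorphism. Unlike twins, x and y may be adjacent, as w and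
-- the top vertex are in μ_t(K₁).
determining-meets : (G : Graph n) → IsSimple G → {S : Subset n} → IsDeterminingSet G S →
  ∀ {x y} → x ≢ y → (∀ z → z ≢ x → z ≢ y → G x z ≡ G y z) →
  lookup S x ≡ true ⊎ lookup S y ≡ true
determining-meets G (symG , loopless) {S} det {x} {y} x≢y same
  with lookup S x in Sx | lookup S y in Sy
... | true  | _     = inj₁ refl
... | false | true  = inj₂ refl
... | false | false = contradiction (trans (sym (det τ τ-aut τ-fixes x)) (transpose-matchˡ x y)) x≢y
  where
  τ = transpose x y

  same′ : ∀ z → z ≢ x → z ≢ y → G z x ≡ G z y
  same′ z z≢x z≢y = trans (symG z x) (trans (same z z≢x z≢y) (symG y z))

  τ-aut : IsAutomorphism G τ
  τ-aut i j with i Fin.≟ x | j Fin.≟ x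
  ... | yes refl | yes refl = trans (loopless y) (sym (loopless x))
  ... | yes refl | no j≢x with j Fin.≟ y
  ...   | yes refl = symG y x
  ...   | no j≢y   = sym (same j j≢x j≢y)
  τ-aut i j | no i≢x | yes refl with i Fin.≟ y
  ...   | yes refl = symG x y
  ...   | no i≢y   = sym (same′ i i≢x i≢y)
  τ-aut i j | no i≢x | no j≢x with i Fin.≟ y | j Fin.≟ y
  ...   | yes refl | yes refl = trans (loopless x) (sym (loopless y))
  ...   | yes refl | no j≢y   = same j j≢x j≢y
  ...   | no i≢y   | yes refl = same′ i i≢x i≢y
  ...   | no _     | no _     = refl

  τ-fixes : ∀ i → i ∈ S → τ ⟨$⟩ʳ i ≡ i
  τ-fixes i i∈S with i Fin.≟ x
  ... | yes refl = contradiction Sx (true≢false (∈⇒true i∈S))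
  ... | no _ with i Fin.≟ y
  ...   | yes refl = contradiction Sy (true≢false (∈⇒true i∈S))
  ...   | no _     = refl

determining-covers : (G : Graph n) → IsSimple G → {S : Subset n} → IsDeterminingSet G S →
  Covers G (lookup S)
determining-covers G simple det x≢y same = determining-meets G simple det x≢y (λ z _ _ → same z)

-- Coordinates and layers of the generalized Mycielskian.

encodeμ : ∀ t → MyVertex n t → Fin (suc (n * suc t))
encodeμ t root        = fzero
encodeμ t (layer i s) = fsuc (combine i s)

decode-encode : ∀ t (x : MyVertex n t) → decodeμ t (encodeμ t x) ≡ x
decode-encode t root = refl
decode-encode {n} t (layer i s) = cong (λ (j , r) → layer j r) (Fin.remQuot-combine {n} i s)

encode-decode : ∀ t (x : Fin (suc (n * suc t))) → encodeμ t (decodeμ {n} t x) ≡ x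
encode-decode t fzero = refl
encode-decode {n} t (fsuc k) = cong fsuc (Fin.combine-remQuot {n} (suc t) k)

encode-injective : ∀ t {x y : MyVertex n t} → encodeμ t x ≡ encodeμ t y → x ≡ y
encode-injective {n} t {x} {y} e =
  trans (sym (decode-encode {n} t x)) (trans (cong (decodeμ {n} t) e) (decode-encode {n} t y))

layer-injective : ∀ {t} {i j : Fin n} {s r : Fin (suc t)} → layer i s ≡ layer j r → i ≡ j × s ≡ r
layer-injective refl = refl , refl

∣∣μ : ∀ t (S : Subset (suc (n * suc t))) →
  ∣ S ∣ ≡ bit (lookup S (encodeμ {n} t root)) + ∑[ i < n ] ∑[ s < suc t ] bit (lookup S (encodeμ t (layer i s)))
∣∣μ {n} t S = trans (∣p∣≡∑ S) (cong (bit (lookup S fzero) +_) (∑-combine n (bit ∘ lookup S ∘ fsuc)))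

-- The condition on layers inside `adjμ`, kept verbatim so that adjacency of layer vertices unfolds
-- to it.
near : ℕ → ℕ → Bool
near a b = ((a ≡ᵇ 0) ∧ (b ≡ᵇ 0)) ∨ (b ≡ᵇ suc a) ∨ (a ≡ᵇ suc b)

near-sym : ∀ a b → near a b ≡ near b a
near-sym a b = cong₂ _∨_ (Bool.∧-comm (a ≡ᵇ 0) (b ≡ᵇ 0)) (Bool.∨-comm (b ≡ᵇ suc a) (a ≡ᵇ suc b))

≡ᵇ-refl : ∀ a → (a ≡ᵇ a) ≡ true
≡ᵇ-refl a = dec-true (a ℕ.≟ a) refl

≡ᵇ-true : ∀ a b → (a ≡ᵇ b) ≡ true → a ≡ b
≡ᵇ-true a b h = ℕ.≡ᵇ⇒≡ a b (Equivalence.from Bool.T-≡ h)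

near-suc : ∀ a → near a (suc a) ≡ true
near-suc a rewrite ≡ᵇ-refl a = Bool.∨-zeroʳ ((a ≡ᵇ 0) ∧ false)

-- `pred` fixes `fzero` and layer 0 is near itself, so the bottom layer needs no separate treatment
-- later.
near-pred : ∀ {m} (s : Fin (suc m)) → near (toℕ s) (toℕ (pred s)) ≡ true
near-pred fzero = refl
near-pred (fsuc s) rewrite Fin.toℕ-inject₁ s = trans (near-sym (suc (toℕ s)) (toℕ s)) (near-suc (toℕ s))

pred≤ : (s : Fin n) → toℕ (pred s) ≤ toℕ s
pred≤ fzero    = z≤n
pred≤ (fsuc s) = ℕ.≤-trans (ℕ.≤-reflexive (Fin.toℕ-inject₁ s)) (ℕ.n≤1+n (toℕ s))

near-cases : ∀ a b → near a b ≡ true → (a ≡ 0 × b ≡ 0) ⊎ (b ≡ suc a ⊎ a ≡ suc b)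
near-cases zero zero h = inj₁ (refl , refl)
near-cases zero (suc b) h with b ≡ᵇ 0 in e
... | true = inj₂ (inj₁ (cong suc (≡ᵇ-true b 0 e)))
near-cases zero (suc b) () | false
near-cases (suc a) b h with b ≡ᵇ suc (suc a) in e
... | true  = inj₂ (inj₁ (≡ᵇ-true b (suc (suc a)) e))
... | false = inj₂ (inj₂ (cong suc (≡ᵇ-true a b h)))

-- Change of presentation, and twins in the generalized Mycielskian.

module Mycielskian {n : ℕ} (G : Graph n) (simple : IsSimple G) (t′ : ℕ) where

  -- The hypothesis t ≥ 1 is built in, and t - 1 is `t′`.
  t : ℕ
  t = suc t′

  V : Set
  V = MyVertex n t

  adj : V → V → Bool
  adj = adjμ t G

  encode : V → Fin (suc (n * suc t))
  encode = encodeμ t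

  decode : Fin (suc (n * suc t)) → V
  decode = decodeμ t

  _≟_ : DecidableEquality V
  _≟_ = via-injection (mk↣ (encode-injective t)) Fin._≟_

  adj-sym : ∀ x y → adj x y ≡ adj y x
  adj-sym root        root        = refl
  adj-sym root        (layer j r) = refl
  adj-sym (layer i s) root        = refl
  adj-sym (layer i s) (layer j r) =
    cong₂ (λ c e → if c then e else false) (near-sym (toℕ s) (toℕ r)) (proj₁ simple i j)

  adj-loopless : ∀ x → adj x x ≡ false
  adj-loopless root        = refl
  adj-loopless (layer i s) = if-false (near (toℕ s) (toℕ s)) (proj₂ simple i)

  μ-simple : IsSimple (μ t G)
  μ-simple = (λ i j → adj-sym (decode i) (decode j)) , (λ i → adj-loopless (decode i))

  -- Conjugation with the encoding carries an automorphism on `MyVertex` to one on `Fin`;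
  -- `⇒determining-μ` conjugates the other way.
  determining-μ⇒ : ∀ {S} → IsDeterminingSet (μ t G) S → Determines adj (lookup S ∘ encode)
  determining-μ⇒ {S} det α fix x = encode-injective t
    (trans (cong (encode ∘ to α) (sym (decode-encode {n} t x)))
      (determining⇒ (μ t G) S det β β-fixes (encode x)))
    where
    β : Aut (μ t G)
    β = record
      { to      = encode ∘ to α ∘ decode
      ; from    = encode ∘ from α ∘ decode
      ; to-from = λ i → trans (cong (encode ∘ to α) (decode-encode {n} t _))
                    (trans (cong encode (to-from α _)) (encode-decode {n} t i))
      ; from-to = λ i → trans (cong (encode ∘ from α) (decode-encode {n} t _))
                    (trans (cong encode (from-to α _)) (encode-decode {n} t i))
      ; adj-to  = λ i j → trans (cong₂ adj (decode-encode {n} t (to α (decode i)))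
                    (decode-encode {n} t (to α (decode j)))) (adj-to α (decode i) (decode j)) }

    β-fixes : Fixes β (lookup S)
    β-fixes i Si = trans (cong encode (fix (decode i) (trans (cong (lookup S) (encode-decode {n} t i)) Si)))
      (encode-decode {n} t i)

  ⇒determining-μ : ∀ {p} → Determines adj p → IsDeterminingSet (μ t G) (tabulate (p ∘ decode))
  ⇒determining-μ {p} det = ⇒determining (μ t G) (p ∘ decode) λ β fix i →
    let
      α : Aut adj
      α = record
        { to      = decode ∘ to β ∘ encode
        ; from    = decode ∘ from β ∘ encode
        ; to-from = λ x → trans (cong (decode ∘ to β) (encode-decode {n} t _))
                      (trans (cong decode (to-from β _)) (decode-encode {n} t x))
        ; from-to = λ x → trans (cong (decode ∘ from β) (encode-decode {n} t _))
                      (trans (cong decode (from-to β _)) (decode-encode {n} t x))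
        ; adj-to  = λ x y → trans (adj-to β (encode x) (encode y))
                      (cong₂ adj (decode-encode {n} t x) (decode-encode {n} t y)) }
      α-fixes : Fixes α p
      α-fixes x px = trans
        (cong decode (fix (encode x) (trans (cong p (decode-encode {n} t x)) px))) (decode-encode {n} t x)
    in trans (sym (encode-decode {n} t (to β i)))
         (trans (cong (encode ∘ decode ∘ to β) (sym (encode-decode {n} t i)))
           (trans (cong encode (det α α-fixes (decode i))) (encode-decode {n} t i)))

  determining-meets-μ : ∀ {S} → IsDeterminingSet (μ t G) S → ∀ {x y} → x ≢ y →
    (∀ z → z ≢ x → z ≢ y → adj x z ≡ adj y z) →
    lookup S (encode x) ≡ true ⊎ lookup S (encode y) ≡ true
  determining-meets-μ det {x} {y} x≢y same =
    determining-meets (μ t G) μ-simple det (x≢y ∘ encode-injective t) λ z z≢x z≢y →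
      trans (cong (λ a → adj a (decode z)) (decode-encode {n} t x))
        (trans (same (decode z) (λ e → z≢x (trans (sym (encode-decode {n} t z)) (cong encode e)))
                                (λ e → z≢y (trans (sym (encode-decode {n} t z)) (cong encode e))))
          (cong (λ a → adj a (decode z)) (sym (decode-encode {n} t y))))

  determining-covers-μ : ∀ {S} → IsDeterminingSet (μ t G) S → Covers adj (lookup S ∘ encode)
  determining-covers-μ det x≢y same = determining-meets-μ det x≢y (λ z _ _ → same z)

  layer-sameNbhd : ∀ {i j} s → SameNbhd G i j → SameNbhd adj (layer i s) (layer j s)
  layer-sameNbhd s same root        = refl
  layer-sameNbhd s same (layer k r) = cong (if near (toℕ s) (toℕ r) then_else false) (same k)

  -- A copy of an isolated vertex has no neighbour except `root`, and that one only from the top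
  -- layer.
  isolated-sameNbhd : ∀ {i j s r} → Isolated G i → Isolated G j → (toℕ s ≡ᵇ t) ≡ (toℕ r ≡ᵇ t) →
    SameNbhd adj (layer i s) (layer j r)
  isolated-sameNbhd               iso-i iso-j top root        = top
  isolated-sameNbhd {s = s} {r = r} iso-i iso-j top (layer k q) =
    trans (if-false (near (toℕ s) (toℕ q)) (iso-i k)) (sym (if-false (near (toℕ r) (toℕ q)) (iso-j k)))

  near-adj : ∀ s r i k → near (toℕ s) (toℕ r) ≡ true → adj (layer i s) (layer k r) ≡ G i k
  near-adj s r i k h rewrite h = refl

  adj-near : ∀ s r {i k} → adj (layer i s) (layer k r) ≡ true → near (toℕ s) (toℕ r) ≡ true × G i k ≡ true
  adj-near s r e with near (toℕ s) (toℕ r)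
  ... | true = refl , e

  top : Fin (suc t)
  top = fromℕ t

  top-true : (toℕ top ≡ᵇ t) ≡ true
  top-true = trans (cong (_≡ᵇ t) (Fin.toℕ-fromℕ t)) (≡ᵇ-refl t)

  root-nbr : ∀ {s} → (toℕ s ≡ᵇ t) ≡ true → s ≡ top
  root-nbr {s} h = Fin.toℕ-injective (trans (≡ᵇ-true (toℕ s) t h) (sym (Fin.toℕ-fromℕ t)))

  -- The distance to the top layer is carried as an equation, so that `level` can recurse on it.
  above : ∀ (s : Fin (suc t)) {r} → toℕ s + suc r ≡ t → Σ (Fin (suc t)) λ s⁺ → toℕ s⁺ ≡ suc (toℕ s)
  above s {r} e = fromℕ< lt , Fin.toℕ-fromℕ< lt
    where
    lt : suc (suc (toℕ s)) ≤ suc t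
    lt = s≤s (subst (suc (toℕ s) ≤_) (trans (sym (ℕ.+-suc (toℕ s) r)) e) (ℕ.m≤m+n (suc (toℕ s)) r))

  near-above : ∀ {s s⁺ : Fin (suc t)} → toℕ s⁺ ≡ suc (toℕ s) → near (toℕ s) (toℕ s⁺) ≡ true
  near-above {s} e rewrite e = near-suc (toℕ s)

  gap : ∀ s → Σ ℕ λ r → toℕ s + r ≡ t
  gap s = t ∸ toℕ s , ℕ.m+[n∸m]≡n (ℕ.≤-pred (Fin.toℕ<n s))

  -- Automorphisms for n ≥ 2, as witnessed by `a` and `b`.

  module Automorphisms {v : Fin n} (iso-v : Isolated G v) {a b : Fin n} (a≢b : a ≢ b) where

    v-nbr : ∀ y → adj (layer v top) y ≡ true → y ≡ root
    v-nbr root        _ = refl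
    v-nbr (layer k r) e = contradiction (if-false (near (toℕ top) (toℕ r)) (iso-v k)) (true≢false e)

    -- A vertex below the top layer is adjacent to two copies of each of its neighbours, so it is no leaf.
    leaf-support : ∀ x y → adj x y ≡ true → (∀ z → adj x z ≡ true → z ≡ y) → y ≡ root
    -- Here n ≥ 2 enters: the top copies of `a` and `b` are two neighbours of `root`, so `root` is
    -- not a leaf.
    leaf-support root y _ unique = contradiction
      (proj₁ (layer-injective (trans (unique (layer a top) top-true) (sym (unique (layer b top) top-true))))) a≢b
    leaf-support (layer j s) root        _ unique = refl
    leaf-support (layer j s) (layer k r) e unique with gap s
    -- In the top layer `root` is a neighbour, hence the only one.
    ... | zero , e₀ = sym (unique root (trans (cong (_≡ᵇ t) (trans (sym (ℕ.+-identityʳ (toℕ s))) e₀)) (≡ᵇ-refl t)))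
    ... | suc _ , e₁ with above s e₁
    ...   | s⁺ , e⁺ = contradiction (trans (cong toℕ pred≡above) e⁺) (ℕ.<⇒≢ (s≤s (pred≤ s)))
      where
      jk : G j k ≡ true
      jk = proj₂ (adj-near s r e)

      pred≡above : pred s ≡ s⁺
      pred≡above = proj₂ (layer-injective (trans
        (unique (layer k (pred s)) (trans (near-adj s (pred s) j k (near-pred s)) jk))
        (sym (unique (layer k s⁺) (trans (near-adj s s⁺ j k (near-above {s} {s⁺} e⁺)) jk)))))

    -- The top copy of `v` is a leaf attached to `root`. Its image is a leaf attached to the image
    -- of `root`, and leaves are attached to `root` only.
    root-fixed : (α : Aut adj) → to α root ≡ root
    root-fixed α = leaf-support (to α (layer v top)) (to α root)
      (trans (adj-to α (layer v top) root) top-true)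
      (λ z e → trans (sym (to-from α z))
        (cong (to α) (v-nbr (from α z) (trans (sym (adj-toˡ α (layer v top) z)) e))))

    layer↛root : (α : Aut adj) → ∀ {i s} → to α (layer i s) ≢ root
    layer↛root α e with to-injective α (trans e (sym (root-fixed α)))
    ... | ()

    adj-root : (α : Aut adj) → ∀ x → adj (to α x) root ≡ adj x root
    adj-root α x = trans (cong (adj (to α x)) (sym (root-fixed α))) (adj-to α x root)

    -- The distance to root determines the layer of a vertex that is not isolated.
    level : ∀ r (α : Aut adj) {i k} s → G i k ≡ true → toℕ s + r ≡ t → ∃ λ j → to α (layer i s) ≡ layer j s
    level zero α {i} s e g with to α (layer i s) in q
    ... | root = contradiction q (layer↛root α)
    ... | layer j r = j , cong (layer j) (trans (root-nbr r-top) (sym (root-nbr s-top)))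
      where
      s-top : (toℕ s ≡ᵇ t) ≡ true
      s-top = trans (cong (_≡ᵇ t) (trans (sym (ℕ.+-identityʳ (toℕ s))) g)) (≡ᵇ-refl t)
      r-top : (toℕ r ≡ᵇ t) ≡ true
      r-top = trans (cong (λ x → adj x root) (sym q)) (trans (adj-root α (layer i s)) s-top)
    level (suc r) α {i} {k} s e g with above s g
    -- By induction the copy of `k` one layer up keeps its layer, so the image of `layer i s` lies
    -- one layer below or one above `s⁺`.
    ... | s⁺ , e⁺ with level r α {k} {i} s⁺ (trans (proj₁ simple k i) e)
                         (trans (cong (_+ r) e⁺) (trans (sym (ℕ.+-suc (toℕ s) r)) g))
    ...   | k′ , qk with to α (layer i s) in q
    ...     | root = contradiction q (layer↛root α)
    ...     | layer j p = j , cong (layer j) (sameLevel (near-cases (toℕ p) (toℕ s⁺) (proj₁ ns)))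
      where
      ns : near (toℕ p) (toℕ s⁺) ≡ true × G j k′ ≡ true
      ns = adj-near p s⁺ (trans (cong₂ adj (sym q) (sym qk))
        (trans (adj-to α (layer i s) (layer k s⁺)) (trans (near-adj s s⁺ i k (near-above {s} {s⁺} e⁺)) e)))

      -- Excludes a jump two layers up. From layer t - 1 there is no such layer; otherwise
      -- `layer j p` is closer to the top, and induction for `α ⁻¹` puts its preimage `layer i s`
      -- into layer `p`.
      skip : ∀ r → toℕ s + suc r ≡ t → toℕ p ≡ suc (suc (toℕ s)) → p ≡ s
      skip zero g ep = contradiction (Fin.toℕ<n p)
        (ℕ.≤⇒≯ (ℕ.≤-reflexive (trans (cong suc (trans (sym g) (ℕ.+-comm (toℕ s) 1))) (sym ep))))
      skip (suc r) g ep with level r (α ⁻¹) {j} {k′} p (proj₂ ns)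
        (trans (cong (_+ r) ep) (trans (sym (trans (ℕ.+-suc (toℕ s) (suc r)) (cong suc (ℕ.+-suc (toℕ s) r)))) g))
      ... | _ , qp = proj₂ (layer-injective (trans (sym qp) (trans (cong (from α) (sym q)) (from-to α _))))

      sameLevel : (toℕ p ≡ 0 × toℕ s⁺ ≡ 0) ⊎ (toℕ s⁺ ≡ suc (toℕ p) ⊎ toℕ p ≡ suc (toℕ s⁺)) → p ≡ s
      sameLevel (inj₁ (_ , z))      = contradiction (trans (sym z) e⁺) λ ()
      sameLevel (inj₂ (inj₁ below)) = Fin.toℕ-injective (ℕ.suc-injective (trans (sym below) e⁺))
      sameLevel (inj₂ (inj₂ ep))    = skip r g (trans ep (cong suc e⁺))

    edge? : ∀ i → Dec (∃ λ k → G i k ≡ true)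
    edge? i = Fin.any? λ k → G i k Bool.≟ true

    ¬edge⇒isolated : ∀ {i} → ¬ (∃ λ k → G i k ≡ true) → Isolated G i
    ¬edge⇒isolated no-edge k = Bool.¬-not λ e → no-edge (k , e)

    -- The value at `root` is a default: automorphisms map no layer vertex there.
    column : V → Fin n
    column root        = v
    column (layer i _) = i

    -- The action on layer 0, corrected to the identity on isolated vertices, whose copies an
    -- automorphism may move to other layers.
    φ : (V → V) → Fin n → Fin n
    φ f i with edge? i
    ... | yes _ = column (f (layer i fzero))
    ... | no  _ = i

    φ-edge : (α : Aut adj) → ∀ {i k} → G i k ≡ true → to α (layer i fzero) ≡ layer (φ (to α) i) fzero
    φ-edge α {i} {k} e with edge? i
    ... | no h  = contradiction (k , e) h
    ... | yes _ with level t α fzero e refl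
    ...   | j , q = trans q (cong (λ x → layer (column x) fzero) (sym q))

    φ-isolated : ∀ f {i} → Isolated G i → φ f i ≡ i
    φ-isolated f {i} iso with edge? i
    ... | no _        = refl
    ... | yes (k , e) = contradiction (iso k) (true≢false e)

    φ-G : (α : Aut adj) → ∀ {i k} → G i k ≡ true → G (φ (to α) i) (φ (to α) k) ≡ true
    φ-G α {i} {k} e = trans
      (cong₂ adj (sym (φ-edge α e)) (sym (φ-edge α (trans (proj₁ simple k i) e))))
      (trans (adj-to α (layer i fzero) (layer k fzero)) e)

    φ-inverse : (α : Aut adj) → ∀ i → φ (from α) (φ (to α) i) ≡ i
    φ-inverse α i = byEdge (edge? i)
      where
      byEdge : Dec (∃ λ k → G i k ≡ true) → φ (from α) (φ (to α) i) ≡ i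
      byEdge (no h) = trans (cong (φ (from α)) (φ-isolated (to α) (¬edge⇒isolated h)))
        (φ-isolated (from α) (¬edge⇒isolated h))
      byEdge (yes (k , e)) = proj₁ (layer-injective
        (trans (sym (φ-edge (α ⁻¹) (φ-G α e))) (trans (cong (from α) (sym (φ-edge α e))) (from-to α _))))

    restrict : Aut adj → Aut G
    restrict α = record
      { to      = φ (to α)
      ; from    = φ (from α)
      ; to-from = φ-inverse (α ⁻¹)
      ; from-to = φ-inverse α
      ; adj-to  = λ i k → ≡-fromTrue
          (λ h → subst₂ (λ x y → G x y ≡ true) (φ-inverse α i) (φ-inverse α k) (φ-G (α ⁻¹) h)) (φ-G α) }

    -- A criterion for determining the generalized Mycielskian.

    module _ {p : V → Bool}
      (det   : Determines G (λ i → p (layer i fzero)))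
      (cover : ∀ s → Covers G (λ i → p (layer i s)))
      (isolated-cover : ∀ {i j s r} → Isolated G i → Isolated G j → (toℕ s ≡ᵇ t) ≡ (toℕ r ≡ᵇ t) →
        layer i s ≢ layer j r → p (layer i s) ≡ true ⊎ p (layer j r) ≡ true)
      where

      module _ (α : Aut adj) (fix : Fixes α p) where

        φ-id : ∀ i → φ (to α) i ≡ i
        φ-id = det (restrict α) φ-fixes
          where
          φ-fixes : ∀ i → p (layer i fzero) ≡ true → φ (to α) i ≡ i
          φ-fixes i pi with edge? i
          ... | no _  = refl
          ... | yes _ = cong column (fix (layer i fzero) pi)

        -- By induction on the layer, a vertex and its image have the same neighbours in the layer below.
        edge-fixed : ∀ m s → toℕ s ≡ m → ∀ {i k} → G i k ≡ true → to α (layer i s) ≡ layer i s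
        edge-fixed zero    fzero    _ {i} e = trans (φ-edge α e) (cong (λ j → layer j fzero) (φ-id i))
        edge-fixed (suc m) (fsuc s) q {i} e = fixed α _≟_ fix twins-meet
          where
          s⁻ = inject₁ s

          same : ∀ {j} → to α (layer i (fsuc s)) ≡ layer j (fsuc s) → SameNbhd G i j
          same {j} h l with edge? l
          -- The induction hypothesis speaks only of vertices with a neighbour; an isolated `l` is
          -- adjacent to neither `i` nor `j`.
          ... | no l-iso = trans (trans (proj₁ simple i l) (¬edge⇒isolated l-iso i))
                             (sym (trans (proj₁ simple j l) (¬edge⇒isolated l-iso j)))
          ... | yes (_ , e′) = trans (sym (near-adj (fsuc s) s⁻ i l (near-pred (fsuc s))))
                (trans (sym (adj-to α (layer i (fsuc s)) (layer l s⁻)))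
                  (trans (cong₂ adj h (edge-fixed m s⁻ (trans (Fin.toℕ-inject₁ s) (ℕ.suc-injective q)) e′))
                    (near-adj (fsuc s) s⁻ j l (near-pred (fsuc s)))))

          twins-meet : layer i (fsuc s) ≢ to α (layer i (fsuc s)) →
            p (layer i (fsuc s)) ≡ true ⊎ p (to α (layer i (fsuc s))) ≡ true
          twins-meet x≢ with gap (fsuc s)
          ... | r , g with level r α (fsuc s) e g
          ...   | j , h = Sum.map₂ (trans (cong p h))
                    (cover (fsuc s) (λ i≡j → x≢ (trans (cong (λ l → layer l (fsuc s)) i≡j) (sym h))) (same h))

        -- The image is again a copy of an isolated vertex, and it is in the top layer exactly if
        -- the original is, so `isolated-cover` applies to the two.
        isolated-fixed : ∀ {i} s → Isolated G i → to α (layer i s) ≡ layer i s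
        isolated-fixed {i} s iso = fixed α _≟_ fix twins-meet
          where
          twins-meet : layer i s ≢ to α (layer i s) → p (layer i s) ≡ true ⊎ p (to α (layer i s)) ≡ true
          twins-meet x≢ with to α (layer i s) in h
          ... | root      = contradiction h (layer↛root α)
          ... | layer j r = isolated-cover iso iso-j
                  (trans (sym (adj-root α (layer i s))) (cong (λ x → adj x root) h)) x≢
            where
            -- An edge from `j` to `k` would make `layer k (pred r)` a neighbour of the image, and
            -- its preimage a neighbour of `layer i s` other than `root`.
            iso-j : Isolated G j
            iso-j k with from α (layer k (pred r)) in f
            ... | root      = contradiction f (layer↛root (α ⁻¹))
            ... | layer l q = trans (sym (near-adj r (pred r) j k (near-pred r)))
                  (trans (cong (λ x → adj x (layer k (pred r))) (sym h))
                    (trans (adj-toˡ α (layer i s) (layer k (pred r)))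
                      (trans (cong (adj (layer i s)) f) (if-false (near (toℕ s) (toℕ q)) (iso l)))))

      determines-μ : Determines adj p
      determines-μ α fix root = root-fixed α
      determines-μ α fix (layer i s) with edge? i
      ... | yes (_ , e) = edge-fixed α fix (toℕ s) s refl e
      ... | no h        = isolated-fixed α fix s (¬edge⇒isolated h)

  not-top : ∀ (s : Fin t) → (toℕ (inject₁ s) ≡ᵇ t) ≡ false
  not-top s = dec-false (toℕ (inject₁ s) ℕ.≟ t)
    (ℕ.<⇒≢ (ℕ.≤-trans (s≤s (ℕ.≤-reflexive (Fin.toℕ-inject₁ s))) (Fin.toℕ<n s)))

  -- `Fin t`, embedded by `inject₁`, indexes the layers 0, ..., t - 1 below the top.
  isolated-meets : ∀ {p} → Covers adj p → ∀ {i j} → Isolated G i → Isolated G j →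
    ∀ {s r : Fin t} → s ≢ r → p (layer i (inject₁ s)) ≡ true ⊎ p (layer j (inject₁ r)) ≡ true
  isolated-meets cover iso-i iso-j {s} {r} s≢r =
    cover (λ e → s≢r (Fin.inject₁-injective (proj₂ (layer-injective e))))
      (isolated-sameNbhd iso-i iso-j (trans (not-top s) (sym (not-top r))))

  -- The upper bound for n ≥ 2.

  module UpperBound {T D : Subset n} (T-cover : IsTwinCover G T) (D-det : IsDeterminingSet G D)
    {v : Fin n} (iso-v : Isolated G v) (Tv : lookup T v ≡ false) where

    -- Layer `fsuc s` is the top one exactly if `toℕ s` is `t′`, so `v` is added in the layers 1,
    -- ..., t - 1.
    p : V → Bool
    p root               = false
    p (layer i fzero)    = lookup D i
    p (layer i (fsuc s)) = lookup T i ∨ (does (v Fin.≟ i) ∧ not (toℕ s ≡ᵇ t′))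

    cover : ∀ s → Covers G (λ i → p (layer i s))
    cover fzero    = determining-covers G simple D-det
    cover (fsuc s) i≢j same = Sum.map (cong (_∨ _)) (cong (_∨ _)) (twinCover⇒covers T-cover i≢j same)

    -- Every other isolated vertex is a twin of `v`, which is outside `T`, so it lies in `T`; `v`
    -- itself is added explicitly.
    isolated-inner : ∀ {i} (s : Fin t) → Isolated G i → (toℕ s ≡ᵇ t′) ≡ false → p (layer i (fsuc s)) ≡ true
    isolated-inner {i} s iso inner with v Fin.≟ i
    ... | yes refl rewrite inner = Bool.∨-zeroʳ (lookup T v)
    ... | no v≢i with twinCover⇒covers T-cover v≢i (isolated-twins G iso-v iso)
    ...   | inj₁ h = contradiction Tv (true≢false h)
    ...   | inj₂ h = cong (_∨ false) h

    isolated-cover : ∀ {i j s r} → Isolated G i → Isolated G j → (toℕ s ≡ᵇ t) ≡ (toℕ r ≡ᵇ t) →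
      layer i s ≢ layer j r → p (layer i s) ≡ true ⊎ p (layer j r) ≡ true
    isolated-cover {s = fzero} {fzero} iso-i iso-j _ x≢y =
      cover fzero (λ i≡j → x≢y (cong (λ l → layer l fzero) i≡j)) (isolated-twins G iso-i iso-j)
    -- Layer 0 is not the top, so `tops` puts the other copy into one of the layers 1, ..., t - 1.
    isolated-cover {s = fzero}  {fsuc r} iso-i iso-j tops _ = inj₂ (isolated-inner r iso-j (sym tops))
    isolated-cover {s = fsuc s} {fzero}  iso-i iso-j tops _ = inj₁ (isolated-inner s iso-i tops)
    isolated-cover {i} {j} {fsuc s} {fsuc r} iso-i iso-j tops x≢y with toℕ s ≡ᵇ t′ in s-top
    ... | false = inj₁ (subst (λ b → lookup T i ∨ (does (v Fin.≟ i) ∧ not b) ≡ true) s-top (isolated-inner s iso-i s-top))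
    ... | true  = Sum.map (cong (_∨ _)) (cong (_∨ _))
                    (twinCover⇒covers T-cover
                      (λ i≡j → x≢y (cong₂ layer i≡j (trans (root-nbr s-top) (sym (root-nbr (sym tops))))))
                      (isolated-twins G iso-i iso-j))

    S : Subset (suc (n * suc t))
    S = tabulate (p ∘ decode)

    S-det : n ≢ 1 → IsDeterminingSet (μ t G) S
    S-det n≢1 = ⇒determining-μ {p} (Automorphisms.determines-μ iso-v (proj₂ (proj₂ (distinct n≢1 v))) {p}
      (determining⇒ G D D-det) cover isolated-cover)
      where
      distinct : ∀ {n} → n ≢ 1 → Fin n → Σ (Fin n) λ a → Σ (Fin n) λ b → a ≢ b
      distinct {suc zero}    n≢1 _ = contradiction refl n≢1
      distinct {suc (suc _)} _   _ = fzero , fsuc fzero , λ ()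

    ∑-notLast : ∀ m → ∑[ s < suc m ] bit (not (toℕ s ≡ᵇ m)) ≡ m
    ∑-notLast zero    = refl
    ∑-notLast (suc m) = cong suc (∑-notLast m)

    bit-∨-∧ : ∀ x y z → bit (x ∨ (y ∧ z)) ≤ bit x + bit y * bit z
    bit-∨-∧ true  y     z = s≤s z≤n
    bit-∨-∧ false false z = z≤n
    bit-∨-∧ false true  z = ℕ.≤-reflexive (sym (ℕ.+-identityʳ (bit z)))

    -- The copies of one vertex are counted together, so that the extra t - 1 falls to the column of
    -- `v` alone and `∑-δ` collects it.
    column-size : ∀ i → ∑[ s < suc t ] bit (p (layer i s)) ≤
      bit (lookup D i) + (t * bit (lookup T i) + bit (does (v Fin.≟ i)) * t′)
    column-size i = ℕ.+-monoʳ-≤ (bit (lookup D i)) (begin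
      ∑[ s < t ] bit (lookup T i ∨ (δ ∧ not (toℕ s ≡ᵇ t′)))
        ≤⟨ ∑-mono-≤ {t} (λ s → bit-∨-∧ (lookup T i) δ (not (toℕ s ≡ᵇ t′))) ⟩
      ∑[ s < t ] (bit (lookup T i) + bit δ * bit (not (toℕ s ≡ᵇ t′)))
        ≡⟨ ∑-distrib-+ (λ (_ : Fin t) → bit (lookup T i)) (λ s → bit δ * bit (not (toℕ s ≡ᵇ t′))) ⟩
      ∑[ s < t ] bit (lookup T i) + ∑[ s < t ] (bit δ * bit (not (toℕ s ≡ᵇ t′)))
        ≡⟨ cong₂ _+_ (∑-const t (bit (lookup T i)))
             (trans (sym (*-distribˡ-sum {t} (bit δ) (λ s → bit (not (toℕ s ≡ᵇ t′)))))
               (cong (bit δ *_) (∑-notLast t′))) ⟩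
      t * bit (lookup T i) + bit δ * t′ ∎)
      where
      open ℕ.≤-Reasoning
      δ = does (v Fin.≟ i)

    S-size : ∣ S ∣ ≤ t * ∣ T ∣ + ∣ D ∣ + t′
    S-size = begin
      ∣ S ∣
        ≡⟨ ∣∣μ {n} t S ⟩
      ∑[ i < n ] ∑[ s < suc t ] bit (lookup S (encode (layer i s)))
        ≡⟨ sum-cong-≗ (λ i → sum-cong-≗ λ s → cong bit
             (trans (lookup∘tabulate (p ∘ decode) (encode (layer i s))) (cong p (decode-encode {n} t (layer i s))))) ⟩
      ∑[ i < n ] ∑[ s < suc t ] bit (p (layer i s))
        ≤⟨ ∑-mono-≤ column-size ⟩
      ∑[ i < n ] (bit (lookup D i) + (t * bit (lookup T i) + bit (does (v Fin.≟ i)) * t′))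
        ≡⟨ ∑-distrib-+ (λ i → bit (lookup D i)) _ ⟩
      ∑[ i < n ] bit (lookup D i) + ∑[ i < n ] (t * bit (lookup T i) + bit (does (v Fin.≟ i)) * t′)
        ≡⟨ cong₂ _+_ (sym (∣p∣≡∑ D)) (∑-distrib-+ (λ i → t * bit (lookup T i)) _) ⟩
      ∣ D ∣ + (∑[ i < n ] (t * bit (lookup T i)) + ∑[ i < n ] (bit (does (v Fin.≟ i)) * t′))
        ≡⟨ cong₂ (λ x y → ∣ D ∣ + (x + y))
             (trans (sym (*-distribˡ-sum t (λ i → bit (lookup T i)))) (cong (t *_) (sym (∣p∣≡∑ T)))) (∑-δ v t′) ⟩
      ∣ D ∣ + (t * ∣ T ∣ + t′)
        ≡⟨ ℕ.+-assoc ∣ D ∣ (t * ∣ T ∣) t′ ⟨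
      ∣ D ∣ + t * ∣ T ∣ + t′
        ≡⟨ cong (_+ t′) (ℕ.+-comm ∣ D ∣ (t * ∣ T ∣)) ⟩
      t * ∣ T ∣ + ∣ D ∣ + t′ ∎
      where open ℕ.≤-Reasoning

  -- The lower bound.

  module LowerBound {T : Subset n} (T-min : IsMinTwinCover G T)
    {v : Fin n} (iso-v : Isolated G v) (Tv : lookup T v ≡ false)
    {S : Subset (suc (n * suc t))} (S-det : IsDeterminingSet (μ t G) S) where

    T-covers : Covers G (lookup T)
    T-covers = twinCover⇒covers (proj₁ T-min)

    p : V → Bool
    p x = lookup S (encode x)

    p-covers : Covers adj p
    p-covers = determining-covers-μ S-det

    p-covers-layer : ∀ s → Covers G (λ i → p (layer i s))
    p-covers-layer s i≢j same =
      p-covers (λ e → i≢j (proj₁ (layer-injective e))) (layer-sameNbhd s same)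

    Full : Fin (suc t) → Fin n → Set
    Full s i = ∀ j → SameNbhd G i j → p (layer j s) ≡ true

    full? : ∀ s i → Dec (Full s i)
    full? s i = Fin.all? λ j → Fin.all? (λ k → G i k Bool.≟ G j k) →-dec (p (layer j s) Bool.≟ true)

    -- i is the one member of its twin class outside T, and S contains the copy of the class in layer s.
    Excess : Fin (suc t) → Fin n → Set
    Excess s i = lookup T i ≡ false × Full s i

    excess? : ∀ s i → Dec (Excess s i)
    excess? s i = (lookup T i Bool.≟ false) ×-dec full? s i

    excess : Fin (suc t) → Fin n → Bool
    excess s i = does (excess? s i)

    -- Without its excess vertices the layer is still a twin cover, to which minimality of `T`
    -- applies: a twin of an excess vertex is in the layer by fullness and in `T`, hence is not
    -- itself removed.
    layer-size : ∀ s → ∣ T ∣ + ∑[ i < n ] bit (excess s i) ≤ ∑[ i < n ] bit (p (layer i s))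
    layer-size s = begin
      ∣ T ∣ + ∑[ i < n ] bit (excess s i)
        ≤⟨ ℕ.+-monoˡ-≤ _ (proj₂ T-min (tabulate trimmed) trimmed-cover) ⟩
      ∣ tabulate trimmed ∣ + ∑[ i < n ] bit (excess s i)
        ≡⟨ cong (_+ ∑[ i < n ] bit (excess s i)) (∣tabulate∣≡∑ trimmed) ⟩
      ∑[ i < n ] bit (trimmed i) + ∑[ i < n ] bit (excess s i)
        ≡⟨ ∑-distrib-+ (λ i → bit (trimmed i)) _ ⟨
      ∑[ i < n ] (bit (trimmed i) + bit (excess s i))
        ≤⟨ ∑-mono-≤ pointwise ⟩
      ∑[ i < n ] bit (p (layer i s)) ∎
      where
      open ℕ.≤-Reasoning

      trimmed : Fin n → Bool
      trimmed i = p (layer i s) ∧ not (excess s i)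

      kept : ∀ {i} → ¬ Excess s i → p (layer i s) ≡ true → i ∈ tabulate trimmed
      kept {i} ¬e pi = true⇒∈ (trans (lookup∘tabulate trimmed i)
        (cong₂ (λ x y → x ∧ not y) pi (dec-false (excess? s i) ¬e)))

      twin-kept : ∀ {i j} → i ≢ j → SameNbhd G i j → Excess s i → j ∈ tabulate trimmed
      twin-kept {i} {j} i≢j same (Ti , full) with T-covers i≢j same
      ... | inj₁ h = contradiction Ti (true≢false h)
      ... | inj₂ h = kept (λ (Tj , _) → true≢false h Tj) (full j same)

      trimmed-cover : IsTwinCover G (tabulate trimmed)
      trimmed-cover i j (i≢j , same) = byExcess (excess? s i) (excess? s j)
        where
        byExcess : Dec (Excess s i) → Dec (Excess s j) → i ∈ tabulate trimmed ⊎ j ∈ tabulate trimmed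
        byExcess (yes e) _       = inj₂ (twin-kept i≢j same e)
        byExcess (no _)  (yes e) = inj₁ (twin-kept (i≢j ∘ sym) (sym ∘ same) e)
        byExcess (no ¬e) (no ¬e′) = Sum.map (kept ¬e) (kept ¬e′) (p-covers-layer s i≢j same)

      pointwise : ∀ i → bit (trimmed i) + bit (excess s i) ≤ bit (p (layer i s))
      pointwise i = byExcess (excess? s i)
        where
        byExcess : (e : Dec (Excess s i)) →
          bit (p (layer i s) ∧ not (does e)) + bit (does e) ≤ bit (p (layer i s))
        byExcess (yes (_ , full)) rewrite full i (λ _ → refl) = s≤s z≤n
        byExcess (no _) with p (layer i s)
        ... | true  = s≤s z≤n
        ... | false = z≤n

    -- At most one of the layers below the top misses a copy of an isolated vertex, as these are all twins.
    isolated-excess : t′ ≤ ∑[ s < suc t ] bit (excess s v)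
    isolated-excess = ℕ.≤-trans
      (ℕ.≤-pred (∑-atMostOneFalse (λ (s : Fin t) → excess (inject₁ s) v) atMostOne))
      -- The term of the top layer is dropped.
      (ℕ.≤-trans (ℕ.m≤m+n _ _) (ℕ.≤-reflexive (sym (sum-init-last (λ (s : Fin (suc t)) → bit (excess s v))))))
      where
      atMostOne : ∀ {s r : Fin t} → s ≢ r → excess (inject₁ s) v ≡ true ⊎ excess (inject₁ r) v ≡ true
      atMostOne {s} {r} s≢r = byFull (full? (inject₁ s) v)
        where
        iso : ∀ {j} → SameNbhd G v j → Isolated G j
        iso same k = trans (sym (same k)) (iso-v k)

        -- A copy missing from layer `r` is a twin of every isolated copy in layer `s`, so layer `s`
        -- would miss none.
        full-r : ¬ Full (inject₁ s) v → Full (inject₁ r) v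
        full-r ¬full j same with p (layer j (inject₁ r)) in pj
        ... | true  = refl
        ... | false = contradiction
          (λ j′ same′ → [ (λ h → h) , (λ h → contradiction pj (true≢false h)) ]′
             (isolated-meets {p} p-covers (iso same′) (iso same) s≢r)) ¬full

        byFull : Dec (Full (inject₁ s) v) → excess (inject₁ s) v ≡ true ⊎ excess (inject₁ r) v ≡ true
        byFull (yes full) = inj₁ (dec-true (excess? (inject₁ s) v) (Tv , full))
        byFull (no ¬full) = inj₂ (dec-true (excess? (inject₁ r) v) (Tv , full-r ¬full))

    somewhere? : ∀ i → Dec (∃ λ s → Excess s i)
    somewhere? i = Fin.any? λ s → excess? s i

    -- v is left out so that its own excess is available for the summand t − 1.
    core : Fin n → Bool
    core i = lookup T i ∨ (not (does (v Fin.≟ i)) ∧ does (somewhere? i))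

    lift : Aut G → Aut adj
    lift α = record
      { to      = λ { root → root ; (layer i s) → layer (to α i) s }
      ; from    = λ { root → root ; (layer i s) → layer (from α i) s }
      ; to-from = λ { root → refl ; (layer i s) → cong (λ j → layer j s) (to-from α i) }
      ; from-to = λ { root → refl ; (layer i s) → cong (λ j → layer j s) (from-to α i) }
      ; adj-to  = λ { root root → refl ; root (layer _ _) → refl ; (layer _ _) root → refl
                    ; (layer i s) (layer j r) → cong (if near (toℕ s) (toℕ r) then_else false) (adj-to α i j) } }

    -- A moved vertex with a copy in `S` would be an excess vertex other than `v`, hence in `core`
    -- and fixed. So the lift of `α` fixes `S` and is the identity.
    core-determines : Determines G core
    core-determines α fix i = proj₁ (layer-injective (determining-μ⇒ S-det (lift α) lift-fixes (layer i fzero)))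
      where
      fix-T : Fixes α (lookup T)
      fix-T j Tj = fix j (cong (_∨ (not (does (v Fin.≟ j)) ∧ does (somewhere? j))) Tj)

      -- `T` is part of `core` and meets `j` or its image if these are twins.
      fixed-twin : ∀ {j} → SameNbhd G j (to α j) → to α j ≡ j
      fixed-twin same = fixed α Fin._≟_ fix-T λ j≢ → T-covers j≢ same

      -- A moved `j` has no twin: a twin `l` would lie in `T` and be fixed, so the image of `j`
      -- would be a twin of `l`, hence of `j`, against `fixed-twin`. Thus `pj` alone makes the class
      -- of `j` full.
      moved-excess : ∀ {j s} → to α j ≢ j → p (layer j s) ≡ true → Excess s j
      moved-excess {j} {s} moved pj = Tj , full
        where
        Tj : lookup T j ≡ false
        Tj = Bool.¬-not (moved ∘ fix-T j)

        full : Full s j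
        full l same with j Fin.≟ l
        ... | yes refl = pj
        ... | no j≢l   = contradiction (fixed-twin λ k → begin
          G j k              ≡⟨ same k ⟩
          G l k              ≡⟨ cong (λ x → G x k) (fix-T l Tl) ⟨
          G (to α l) k       ≡⟨ adj-toˡ α l k ⟩
          G l (from α k)     ≡⟨ same (from α k) ⟨
          G j (from α k)     ≡⟨ adj-toˡ α j k ⟨
          G (to α j) k       ∎) moved
          where
          open ≡-Reasoning
          Tl : lookup T l ≡ true
          Tl = [ (λ h → contradiction Tj (true≢false h)) , (λ h → h) ]′ (T-covers j≢l same)

      lift-fixes : Fixes (lift α) p
      lift-fixes root        _  = refl
      lift-fixes (layer j s) pj with to α j Fin.≟ j
      ... | yes e    = cong (λ l → layer l s) e
      ... | no moved = contradiction (fix j in-core) moved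
        where
        -- `v` is fixed without being in `core`, since its image is isolated and so has the same
        -- neighbourhood.
        v≢j : v ≢ j
        v≢j refl = moved (fixed-twin λ k → trans (iso-v k) (sym (trans (adj-toˡ α v k) (iso-v (from α k)))))

        in-core : core j ≡ true
        in-core = trans (cong₂ (λ x y → lookup T j ∨ (not x ∧ y)) (dec-false (v Fin.≟ j) v≢j)
                  (dec-true (somewhere? j) (s , moved-excess {j} {s} moved pj))) (Bool.∨-zeroʳ (lookup T j))

    -- At `v` the bit of `core` is 0 and the excess pays for t - 1. Elsewhere membership in `T` or a
    -- single layer with excess pays for `core`.
    column-bound : ∀ i → bit (core i) + bit (does (v Fin.≟ i)) * t′ ≤ bit (lookup T i) + ∑[ s < suc t ] bit (excess s i)
    column-bound i with v Fin.≟ i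
    ... | yes refl = ℕ.≤-trans
      (ℕ.≤-reflexive (cong₂ _+_ (cong (λ x → bit (x ∨ false)) Tv) (ℕ.+-identityʳ t′)))
      (ℕ.≤-trans isolated-excess (ℕ.m≤n+m _ (bit (lookup T i))))
    ... | no _ = bySomewhere (lookup T i) (somewhere? i)
      where
      bySomewhere : ∀ x (e : Dec (∃ λ s → Excess s i)) →
        bit (x ∨ does e) + 0 ≤ bit x + ∑[ s < suc t ] bit (excess s i)
      bySomewhere true  _             = s≤s z≤n
      bySomewhere false (no _)        = z≤n
      bySomewhere false (yes (s , e)) = ℕ.≤-trans (ℕ.≤-reflexive (cong bit (sym (dec-true (excess? s i) e))))
        (term≤∑ (λ r → bit (excess r i)) s)

    -- Of the t + 1 copies of `∣ T ∣` supplied by `layer-size`, one joins the total excess `X` to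
    -- pay for d + t - 1, and t remain.
    S-bound : ∀ {d} → IsDet G d → t * ∣ T ∣ + d + t′ ≤ ∣ S ∣
    S-bound {d} (_ , d-min) = begin
      t * ∣ T ∣ + d + t′
        ≡⟨ ℕ.+-assoc (t * ∣ T ∣) d t′ ⟩
      t * ∣ T ∣ + (d + t′)
        ≤⟨ ℕ.+-monoʳ-≤ (t * ∣ T ∣) d+t′≤ ⟩
      t * ∣ T ∣ + (∣ T ∣ + X)
        ≡⟨ ℕ.+-assoc (t * ∣ T ∣) ∣ T ∣ X ⟨
      t * ∣ T ∣ + ∣ T ∣ + X
        ≡⟨ cong (_+ X) (ℕ.+-comm (t * ∣ T ∣) ∣ T ∣) ⟩
      suc t * ∣ T ∣ + X
        ≡⟨ cong (_+ X) (∑-const (suc t) ∣ T ∣) ⟨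
      ∑[ s < suc t ] ∣ T ∣ + X
        ≡⟨ ∑-distrib-+ {suc t} (λ _ → ∣ T ∣) (λ s → ∑[ i < n ] bit (excess s i)) ⟨
      ∑[ s < suc t ] (∣ T ∣ + ∑[ i < n ] bit (excess s i))
        ≤⟨ ∑-mono-≤ layer-size ⟩
      ∑[ s < suc t ] ∑[ i < n ] bit (p (layer i s))
        ≡⟨ ∑-comm {suc t} {n} (λ s i → bit (p (layer i s))) ⟩
      ∑[ i < n ] ∑[ s < suc t ] bit (p (layer i s))
        ≤⟨ ℕ.m≤n+m _ _ ⟩
      bit (p root) + ∑[ i < n ] ∑[ s < suc t ] bit (p (layer i s))
        ≡⟨ ∣∣μ {n} t S ⟨
      ∣ S ∣ ∎
      where
      open ℕ.≤-Reasoning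

      X : ℕ
      X = ∑[ s < suc t ] ∑[ i < n ] bit (excess s i)

      d+t′≤ : d + t′ ≤ ∣ T ∣ + X
      d+t′≤ = begin
        d + t′
          ≤⟨ ℕ.+-monoˡ-≤ t′ (d-min (tabulate core) (⇒determining G core core-determines)) ⟩
        ∣ tabulate core ∣ + t′
          ≡⟨ cong₂ _+_ (∣tabulate∣≡∑ core) (sym (∑-δ v t′)) ⟩
        ∑[ i < n ] bit (core i) + ∑[ i < n ] (bit (does (v Fin.≟ i)) * t′)
          ≡⟨ ∑-distrib-+ (λ i → bit (core i)) _ ⟨
        ∑[ i < n ] (bit (core i) + bit (does (v Fin.≟ i)) * t′)
          ≤⟨ ∑-mono-≤ column-bound ⟩
        ∑[ i < n ] (bit (lookup T i) + ∑[ s < suc t ] bit (excess s i))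
          ≡⟨ ∑-distrib-+ (λ i → bit (lookup T i)) _ ⟩
        ∑[ i < n ] bit (lookup T i) + ∑[ i < n ] ∑[ s < suc t ] bit (excess s i)
          ≡⟨ cong₂ _+_ (sym (∣p∣≡∑ T)) (∑-comm {n} {suc t} (λ i s → bit (excess s i))) ⟩
        ∣ T ∣ + X ∎

-- The graph with one vertex.

module SingleVertex (G : Graph 1) (simple : IsSimple G) (t′ : ℕ) where

  open Mycielskian G simple t′

  isolated : Isolated G fzero
  isolated fzero = proj₂ simple fzero

  det-K₁ : IsDet G 0
  det-K₁ = isDet (λ _ _ → z≤n) ⊥ (λ { σ _ _ fzero → unique (σ ⟨$⟩ʳ fzero) }) z≤n
    where
    unique : (i : Fin 1) → i ≡ fzero
    unique fzero = refl

  -- The Mycielskian consists of the edge between `root` and the top vertex and of t isolated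
  -- vertices. One vertex of the edge and one isolated vertex are left out.
  p : V → Bool
  p root                   = false
  p (layer fzero fzero)    = false
  p (layer fzero (fsuc s)) = true

  -- The top vertex is fixed and adjacent to `root` but to no layer vertex, so `root` is fixed;
  -- injectivity then leaves only layer 0 for the image of layer 0.
  p-determines : Determines adj p
  p-determines α fix = everywhere
    where
    root-fixed : to α root ≡ root
    root-fixed with to α root in q
    ... | root          = refl
    ... | layer fzero s = contradiction (if-false (near (toℕ s) (toℕ top)) (isolated fzero))
      (true≢false (trans (cong₂ adj (sym q) (sym (fix (layer fzero top) refl)))
        (trans (adj-to α root (layer fzero top)) top-true)))

    everywhere : ∀ x → to α x ≡ x
    everywhere root                   = root-fixed
    everywhere (layer fzero (fsuc s)) = fix _ refl
    everywhere (layer fzero fzero) with to α (layer fzero fzero) in q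
    ... | root                 with to-injective α (trans q (sym root-fixed))
    ...   | ()
    everywhere (layer fzero fzero) | layer fzero fzero    = refl
    everywhere (layer fzero fzero) | layer fzero (fsuc s)
      with to-injective α (trans q (sym (fix (layer fzero (fsuc s)) refl)))
    ...   | ()

  det-μK₁ : IsDet (μ t G) t
  det-μK₁ = isDet lower (tabulate (p ∘ decode)) (⇒determining-μ {p} p-determines) upper
    where
    open ℕ.≤-Reasoning

    upper : ∣ tabulate (p ∘ decode) ∣ ≤ t
    upper = begin
      ∣ tabulate (p ∘ decode) ∣
        ≡⟨ ∣∣μ {1} t (tabulate (p ∘ decode)) ⟩
      ∑[ s < suc t ] bit (lookup (tabulate (p ∘ decode)) (encode (layer fzero s))) + 0
        ≡⟨ ℕ.+-identityʳ _ ⟩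
      ∑[ s < suc t ] bit (lookup (tabulate (p ∘ decode)) (encode (layer fzero s)))
        ≡⟨ sum-cong-≗ (λ s → cong bit (trans (lookup∘tabulate (p ∘ decode) (encode (layer fzero s)))
             (cong p (decode-encode {1} t (layer fzero s))))) ⟩
      ∑[ s < suc t ] bit (p (layer fzero s))
        ≡⟨ ∑-allTrue {t} (λ _ → refl) ⟩
      t ∎

    -- One element comes from the edge, whose ends can be exchanged, and t - 1 come from the t
    -- isolated vertices, which are mutual twins.
    lower : ∀ S → IsDeterminingSet (μ t G) S → t ≤ ∣ S ∣
    lower S det = begin
      t
        ≤⟨ ℕ.+-mono-≤ root-or-top (ℕ.≤-pred (∑-atMostOneFalse {t} (λ s → q (layer fzero (inject₁ s)))
             (isolated-meets {q} (determining-covers-μ det) isolated isolated))) ⟩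
      bit (q root) + bit (q (layer fzero top)) + ∑[ s < t ] bit (q (layer fzero (inject₁ s)))
        ≡⟨ ℕ.+-assoc (bit (q root)) _ _ ⟩
      bit (q root) + (bit (q (layer fzero top)) + ∑[ s < t ] bit (q (layer fzero (inject₁ s))))
        ≡⟨ cong (bit (q root) +_) (trans (ℕ.+-comm (bit (q (layer fzero top))) _)
             (trans (sym (sum-init-last (λ (s : Fin (suc t)) → bit (q (layer fzero s))))) (sym (ℕ.+-identityʳ _)))) ⟩
      bit (q root) + (∑[ s < suc t ] bit (q (layer fzero s)) + 0)
        ≡⟨ ∣∣μ {1} t S ⟨
      ∣ S ∣ ∎
      where
      q : V → Bool
      q x = lookup S (encode x)

      same : ∀ z → z ≢ root → z ≢ layer fzero top → adj root z ≡ adj (layer fzero top) z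
      same root            z≢root _     = contradiction refl z≢root
      same (layer fzero s) _      z≢top = trans
        (Bool.¬-not λ s-top → z≢top (cong (layer fzero) (root-nbr s-top)))
        (sym (if-false (near (toℕ top) (toℕ s)) (isolated fzero)))

      root-or-top : 1 ≤ bit (q root) + bit (q (layer fzero top))
      root-or-top with determining-meets-μ det {root} {layer fzero top} (λ ()) same
      ... | inj₁ h rewrite h = s≤s z≤n
      ... | inj₂ h rewrite h = ℕ.m≤n+m 1 _

theorem3p20 : ∀ (n : ℕ) (G : Graph n) → IsSimple G → HasIsolatedVertex G →
    (T : Subset n) → IsMinTwinCover G T → (t : ℕ) → 1 ≤ t →
    (n ≡ 1 → IsDet G 0 × IsDet (μ t G) t) ×
    (n ≢ 1 → ∀ (d : ℕ) → IsDet G d → IsDet (μ t G) (t * ∣ T ∣ + d + (t ∸ 1)))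
theorem3p20 n G simple isolated T T-min (suc t′) _ = single , multiple
  where
  single : n ≡ 1 → IsDet G 0 × IsDet (μ (suc t′) G) (suc t′)
  single refl = SingleVertex.det-K₁ G simple t′ , SingleVertex.det-μK₁ G simple t′

  multiple : n ≢ 1 → ∀ d → IsDet G d → IsDet (μ (suc t′) G) (suc t′ * ∣ T ∣ + d + t′)
  -- Matching on `refl` turns `d` into `∣ D ∣`, the form in which `S-size` gives the upper bound;
  -- minimality of `d` enters through `S-bound`.
  multiple n≢1 d det@((D , D-det , refl) , _) with uncovered-isolated isolated T-min
  ... | v , iso-v , Tv = isDet (λ S S-det → LowerBound.S-bound T-min iso-v Tv S-det det) S (S-det n≢1) S-size
    where
    open Mycielskian G simple t′
    open UpperBound (proj₁ T-min) D-det iso-v Tv
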